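{- Let $(T,s)$ be an instance of the firefighter problem where $T$ is a tree of maximum degree at most $3$ and the source $s$ has degree two. Let $(x,y)$ be a feasible solution of the LP relaxation (LP') (the LP with Hartke's constraints). Then there is a polynomial time algorithm that computes a strategy saving at least $\sum_{v\in V(T)}y_v$ vertices.
   Context: $T=(V,E)$ is a finite tree rooted at the source $s$ where the fire starts. A strategy is a sequence $\{u_t\}_{t\ge1}$ of vertices, $u_t$ being picked at time $t$. A vertex $u$ is saved if on the path $(s=v_0,\dots,v_z=u)$ we have $v_i\in\{u_1,\dots,u_i\}$ for some $i\in\{1,\dots,z\}$. For $j\ge 1$ let $L_j$ be the set of vertices at distance exactly $j$ from $s$, let $P_v$ be the set of vertices on the path from $s$ to $v$, and let $T_v$ be the subtree rooted at $v$. (LP') is: maximize $\sum_{v\in V}y_v$ subject to $\sum_{u\in P_v\cup(T_v\cap L_j)}x_u\le1$ for every vertex $v$ and every layer $L_j$ below the layer of $v$; $y_v\le\sum_{u\in P_v}x_u$ for every $v\in V$; $x_v,y_v\in[0,1]$ for every $v$; and $x_s=0$ (the source cannot be picked).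
   Formalization: The feasible solution (x,y) of (LP') is taken to be rational-valued, whereas the English allows real values in [0,1]. -}

module Defs where

open import Data.Fin.Base using (Fin; toℕ)
import Data.Fin.Properties as Fin
open import Data.Integer.Base using (ℤ; +_; -[1+_])
open import Data.List.Base
  using (List; []; _∷_; map; filter; foldr; length; take; concatMap; allFin; tabulate)
open import Data.List.Membership.Propositional using (_∈_)
import Data.List.Membership.DecPropositional as DecMembership
open import Data.List.Relation.Unary.Any using (Any; any?)
open import Data.Nat.Base using (ℕ; zero; suc; _+_; _*_; _^_; _≤_; _<_)
import Data.Nat.Properties as ℕ
open import Data.Nat.Binary.Base using (ℕᵇ; zero; 2[1+_]; 1+[2_]; fromℕ)
open import Data.Product.Base using (∃-syntax; _×_)
open import Data.Rational.Base as ℚ using (ℚ; 0ℚ; 1ℚ)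
open import Data.Vec.Base using (Vec; _∷_; lookup; replicate; _[_]≔_)
open import Level using (0ℓ)
open import Relation.Binary.Definitions using (DecidableEquality)
open import Relation.Binary.PropositionalEquality.Core using (_≡_; _≢_; refl)
open import Relation.Nullary.Decidable.Core using (yes; no)
open import Relation.Unary using (Pred; Decidable; _∪_; _∩_)
open import Relation.Unary.Properties using (_∪?_; _∩?_)

------------------------------------------------------------------------
-- Finite rooted trees

data Tree : Set where
  node : (k : ℕ) → (Fin k → Tree) → Tree

arity : Tree → ℕ
arity (node k c) = k

subtree : (T : Tree) → Fin (arity T) → Tree
subtree (node k c) = c

-- A vertex is given by the child indices along the way to it from the root.
data Vertex (T : Tree) : Set where
  root  : Vertex T
  child : (i : Fin (arity T)) → Vertex (subtree T i) → Vertex T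

vertices : (T : Tree) → List (Vertex T)
vertices (node k c) =
  root ∷ concatMap (λ i → map (child i) (vertices (c i))) (allFin k)

_≟_ : ∀ {T} → DecidableEquality (Vertex T)
root      ≟ root      = yes refl
root      ≟ child _ _ = no λ ()
child _ _ ≟ root      = no λ ()
child i u ≟ child j v with i Fin.≟ j
... | no i≢j = no λ { refl → i≢j refl }
... | yes refl with u ≟ v
...   | no u≢v   = no λ { refl → u≢v refl }
...   | yes refl = yes refl

_∈?_ : ∀ {T} (v : Vertex T) → Decidable (λ (vs : List (Vertex T)) → v ∈ vs)
v ∈? vs = DecMembership._∈?_ _≟_ v vs

-- Distance from the root.
depth : ∀ {T} → Vertex T → ℕ
depth root        = 0
depth (child _ v) = suc (depth v)

-- The path v₀, …, v_z from the root v₀ to v = v_z.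
path : ∀ {T} → Vertex T → List (Vertex T)
path root        = root ∷ []
path (child i v) = root ∷ map (child i) (path v)

childCount : ∀ {T} → Vertex T → ℕ
childCount {T} root    = arity T
childCount (child _ v) = childCount v

-- Every vertex other than the root is also adjacent to its parent.
degree : ∀ {T} → Vertex T → ℕ
degree {T} root      = arity T
degree v@(child _ _) = suc (childCount v)

MaxDegree≤ : ℕ → Tree → Set
MaxDegree≤ d T = (v : Vertex T) → degree v ≤ d

------------------------------------------------------------------------
-- Firefighting strategies; the fire starts at the root

-- The list u₁ ∷ u₂ ∷ … ; nothing is picked after its end.
Strategy : Tree → Set
Strategy T = List (Vertex T)

-- The i-th vertex vᵢ of the path has depth i, so this says vᵢ ∈ {u₁, …, uᵢ}
-- for some i; the case i = 0 is void because take 0 σ is empty.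
Saved : ∀ {T} → Strategy T → Pred (Vertex T) 0ℓ
Saved σ u = Any (λ v → v ∈ take (depth v) σ) (path u)

saved? : ∀ {T} (σ : Strategy T) → Decidable (Saved σ)
saved? σ u = any? (λ v → v ∈? take (depth v) σ) (path u)

savedCount : ∀ {T} → Strategy T → ℕ
savedCount {T} σ = length (filter (saved? σ) (vertices T))

------------------------------------------------------------------------
-- The linear program with Hartke's constraints

sumℚ : List ℚ → ℚ
sumℚ = foldr ℚ._+_ 0ℚ

∑ : ∀ {T} → (Vertex T → ℚ) → ℚ
∑ {T} f = sumℚ (map f (vertices T))

∑∈ : ∀ {T} {S : Pred (Vertex T) 0ℓ} → Decidable S → (Vertex T → ℚ) → ℚ
∑∈ {T} S? f = sumℚ (map f (filter S? (vertices T)))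

P : ∀ {T} → Vertex T → Pred (Vertex T) 0ℓ
P v u = u ∈ path v

P? : ∀ {T} (v : Vertex T) → Decidable (P v)
P? v u = u ∈? path v

-- The vertices of the subtree rooted at v.
Below : ∀ {T} → Vertex T → Pred (Vertex T) 0ℓ
Below v u = v ∈ path u

below? : ∀ {T} (v : Vertex T) → Decidable (Below v)
below? v u = v ∈? path u

L : ∀ {T} → ℕ → Pred (Vertex T) 0ℓ
L j u = depth u ≡ j

L? : ∀ {T} (j : ℕ) → Decidable (L {T} j)
L? j u = depth u ℕ.≟ j

In[0,1] : ℚ → Set
In[0,1] q = 0ℚ ℚ.≤ q × q ℚ.≤ 1ℚ

record Feasible (T : Tree) (x y : Vertex T → ℚ) : Set where
  field
    hartke : ∀ v j → depth v < j → ∑∈ (P? v ∪? (below? v ∩? L? j)) x ℚ.≤ 1ℚ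
    cover  : ∀ v → y v ℚ.≤ ∑∈ (P? v) x
    x-unit : ∀ v → In[0,1] (x v)
    y-unit : ∀ v → In[0,1] (y v)
    source : x root ≡ 0ℚ

------------------------------------------------------------------------
-- Model of computation: Jones's language WHILE over binary trees
-- (N. D. Jones, Computability and Complexity from a Programming
-- Perspective), which is polynomially equivalent to Turing machines.

infixr 5 _∙_

data Datum : Set where
  nil : Datum
  _∙_ : Datum → Datum → Datum

size : Datum → ℕ
size nil     = 1
size (d ∙ e) = suc (size d + size e)

head tail : Datum → Datum
head nil     = nil
head (d ∙ e) = d
tail nil     = nil
tail (d ∙ e) = e

-- Expressions and commands over n variables.
data Expr (n : ℕ) : Set where
  var   : Fin n → Expr n
  nil   : Expr n
  cons  : Expr n → Expr n → Expr n
  hd tl : Expr n → Expr n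

infixr 4 _⨾_
infix  5 _:=_

data Cmd (n : ℕ) : Set where
  skip          : Cmd n
  _:=_          : Fin n → Expr n → Cmd n
  _⨾_           : Cmd n → Cmd n → Cmd n
  if_then_else_ : Expr n → Cmd n → Cmd n → Cmd n
  while_run_    : Expr n → Cmd n → Cmd n

Store : ℕ → Set
Store n = Vec Datum n

eval : ∀ {n} → Store n → Expr n → Datum
eval ρ (var i)    = lookup ρ i
eval ρ nil        = nil
eval ρ (cons e f) = eval ρ e ∙ eval ρ f
eval ρ (hd e)     = head (eval ρ e)
eval ρ (tl e)     = tail (eval ρ e)

cost : ∀ {n} → Expr n → ℕ
cost (var i)    = 1
cost nil        = 1
cost (cons e f) = suc (cost e + cost f)
cost (hd e)     = suc (cost e)
cost (tl e)     = suc (cost e)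

-- C , ρ ⇓[ t ] ρ′ : command C, started in ρ, halts in ρ′ after t steps.
-- A test succeeds when its value is not nil.
infix 3 _,_⇓[_]_

data _,_⇓[_]_ {n : ℕ} : Cmd n → Store n → ℕ → Store n → Set where
  skip : ∀ {ρ} →
    skip , ρ ⇓[ 1 ] ρ
  assign : ∀ {i e ρ} →
    (i := e) , ρ ⇓[ suc (cost e) ] (ρ [ i ]≔ eval ρ e)
  seq : ∀ {C D ρ ρ′ ρ″ s t} →
    C , ρ ⇓[ s ] ρ′ → D , ρ′ ⇓[ t ] ρ″ →
    (C ⨾ D) , ρ ⇓[ s + t ] ρ″
  if-true : ∀ {e C D ρ ρ′ t} →
    eval ρ e ≢ nil → C , ρ ⇓[ t ] ρ′ →
    (if e then C else D) , ρ ⇓[ suc (cost e + t) ] ρ′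
  if-false : ∀ {e C D ρ ρ′ t} →
    eval ρ e ≡ nil → D , ρ ⇓[ t ] ρ′ →
    (if e then C else D) , ρ ⇓[ suc (cost e + t) ] ρ′
  while-stop : ∀ {e C ρ} →
    eval ρ e ≡ nil →
    (while e run C) , ρ ⇓[ suc (cost e) ] ρ
  while-step : ∀ {e C ρ ρ′ ρ″ s t} →
    eval ρ e ≢ nil → C , ρ ⇓[ s ] ρ′ → (while e run C) , ρ′ ⇓[ t ] ρ″ →
    (while e run C) , ρ ⇓[ suc (cost e + s + t) ] ρ″

-- Variable 0 holds the input at the start and the output at the end.
record Program : Set where
  constructor program
  field
    {locals} : ℕ
    body     : Cmd (suc locals)

-- Program p computes the output from the input within the given time.
-- A cons takes one step because values may be shared, so an output could be
-- exponentially larger than the number of steps; the size of the output is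
-- therefore charged as well.
Computes_from_to_within_ : Program → Datum → Datum → ℕ → Set
Computes p from input to output within time =
  ∃[ ρ ] ∃[ t ] (body , (input ∷ replicate locals nil) ⇓[ t ] (output ∷ ρ))
              × t + size output ≤ time
  where open Program p

-- Every polynomial over ℕ is bounded by one of this form.
polynomial : (c k : ℕ) → ℕ → ℕ
polynomial c k n = c * n ^ k + c

------------------------------------------------------------------------
-- Encodings

encodeList : List Datum → Datum
encodeList = foldr _∙_ nil

unary : ℕ → Datum
unary zero    = nil
unary (suc n) = nil ∙ unary n

binary : ℕᵇ → Datum
binary zero     = nil
binary 2[1+ b ] = nil ∙ binary b
binary 1+[2 b ] = (nil ∙ nil) ∙ binary b

encodeℤ : ℤ → Datum
encodeℤ (+ n)    = nil ∙ binary (fromℕ n)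
encodeℤ -[1+ n ] = (nil ∙ nil) ∙ binary (fromℕ (suc n))

encodeℚ : ℚ → Datum
encodeℚ q = encodeℤ (ℚ.numerator q) ∙ binary (fromℕ (ℚ.denominatorℕ q))

encodeTree : Tree → Datum
encodeTree (node k c) = encodeList (tabulate (λ i → encodeTree (c i)))

encodeVertex : ∀ {T} → Vertex T → Datum
encodeVertex root        = nil
encodeVertex (child i v) = unary (toℕ i) ∙ encodeVertex v

encodeStrategy : ∀ {T} → Strategy T → Datum
encodeStrategy σ = encodeList (map encodeVertex σ)

encodeValues : ∀ {T} → (Vertex T → ℚ) → Datum
encodeValues {T} f = encodeList (map (λ v → encodeℚ (f v)) (vertices T))

encodeInput : (T : Tree) (x y : Vertex T → ℚ) → Datum
encodeInput T x y = encodeTree T ∙ encodeValues x ∙ encodeValues y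

{-# OPTIONS --safe #-}

-- As no vertex has more than two children, protecting at each step one child of the
-- burning vertex of the current level leaves at most one vertex of that level on fire,
-- and the fire stops at a vertex with at most one child. Steered towards such a vertex
-- of least depth h, which breadth-first search finds, it burns at most h + 1 vertices.
--
-- No LP solution does better. The vertices of depth below h all have two children.
-- Let r v be 1 minus the x-weight of the path to v, and Qₜ, Xₜ the sums of r and x over
-- level t. Then Q₀ = 1, Qₜ₊₁ = 2 Qₜ − Xₜ₊₁ for t < h, and Hartke's constraint at the
-- source says Xₜ ≤ 1, so Qₜ ≥ 1 for t ≤ h by induction. Since 1 − y v ≥ r v and
-- 1 − y v ≥ 0, summing over the levels 0, …, h gives ∑ (1 − y) ≥ h + 1.
module Submission where

open import Defs
open import Data.Fin.Base using (Fin; zero; suc; toℕ; opposite)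
open import Data.Integer.Base using (+_)
import Data.Integer.Base as ℤ
import Data.Integer.Properties as ℤ
open import Data.List.Base
  using (List; []; _∷_; _++_; map; filter; length; concatMap; allFin; tabulate; take)
open import Data.List.Membership.Propositional using (_∈_)
open import Data.List.Membership.Propositional.Properties using (∈-map⁺; ∈-map⁻)
import Data.List.Properties as List
open import Data.List.Relation.Unary.Any as Any using (Any; here; there)
import Data.List.Relation.Unary.Any.Properties as Any
open import Data.Nat.Base using (ℕ; zero; suc; z≤n; s≤s)
import Data.Nat.Base as ℕ
open import Data.Nat.ListAction using (sum)
import Data.Nat.Properties as ℕ
open import Data.Nat.Solver renaming (module +-*-Solver to ℕ-Solver)
open import Data.Product.Base using (Σ-syntax; ∃-syntax; _×_; _,_; proj₁; proj₂)
open import Data.Rational.Base using (ℚ; _≤_; _/_)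
open import Data.Rational.Literals using (fromℤ)
import Data.Rational.Properties as ℚ
open import Data.Sum.Base as Sum using (_⊎_; inj₁; inj₂)
open import Data.Unit.Base using (tt)
open import Data.Vec.Base using ([]; _∷_)
open import Function.Base using (_∘_; const; id)
open import Level using (0ℓ)
open import Relation.Binary.PropositionalEquality
open import Relation.Nullary using (¬_; contradiction; yes; no)
open import Relation.Unary using (Pred; Decidable)
open import Relation.Unary.Properties using (_∪?_; _∩?_)

-- Upper bound on the LP objective

module LinearProgram where

  open import Data.Rational.Base using (0ℚ; 1ℚ; _+_; _-_; -_)
  open import Data.Rational.Solver using (module +-*-Solver)
  open +-*-Solver using (solve; con; _:+_; _:-_) renaming (_:=_ to _:≡_)

  ∑-node : ∀ {k c} (f : Vertex (node k c) → ℚ) →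
           ∑ f ≡ f root + sumℚ (map (λ i → ∑ (f ∘ child i)) (allFin k))
  ∑-node {k} {c} f = cong (_+_ (f root)) (go (allFin k))
    where
    sumℚ-++ : ∀ ps qs → sumℚ (ps ++ qs) ≡ sumℚ ps + sumℚ qs
    sumℚ-++ []       qs = sym (ℚ.+-identityˡ _)
    sumℚ-++ (p ∷ ps) qs = trans (cong (_+_ p) (sumℚ-++ ps qs)) (sym (ℚ.+-assoc p _ _))

    go : ∀ is → sumℚ (map f (concatMap (λ i → map (child i) (vertices (c i))) is))
              ≡ sumℚ (map (λ i → ∑ (f ∘ child i)) is)
    go []       = refl
    go (i ∷ is) = begin
      sumℚ (map f (map (child i) (vertices (c i)) ++ rest))
        ≡⟨ cong sumℚ (List.map-++ f (map (child i) (vertices (c i))) rest) ⟩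
      sumℚ (map f (map (child i) (vertices (c i))) ++ map f rest)
        ≡⟨ sumℚ-++ (map f (map (child i) (vertices (c i)))) (map f rest) ⟩
      sumℚ (map f (map (child i) (vertices (c i)))) + sumℚ (map f rest)
        ≡⟨ cong₂ _+_ (cong sumℚ (sym (List.map-∘ (vertices (c i))))) (go is) ⟩
      ∑ (f ∘ child i) + sumℚ (map (λ i → ∑ (f ∘ child i)) is) ∎
      where
      open ≡-Reasoning
      rest = concatMap (λ i → map (child i) (vertices (c i))) is

  module _ {A : Set} where

    sumℚ-mono : ∀ {f g : A → ℚ} → (∀ a → f a ≤ g a) → ∀ as → sumℚ (map f as) ≤ sumℚ (map g as)
    sumℚ-mono f≤g []       = ℚ.≤-refl
    sumℚ-mono f≤g (a ∷ as) = ℚ.+-mono-≤ (f≤g a) (sumℚ-mono f≤g as)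

    sumℚ-+ : ∀ (f g : A → ℚ) as →
             sumℚ (map (λ a → f a + g a) as) ≡ sumℚ (map f as) + sumℚ (map g as)
    sumℚ-+ f g []       = refl
    sumℚ-+ f g (a ∷ as) = trans (cong (_+_ (f a + g a)) (sumℚ-+ f g as))
      (solve 4 (λ p q r s → (p :+ q) :+ (r :+ s) :≡ (p :+ r) :+ (q :+ s)) refl
        (f a) (g a) (sumℚ (map f as)) (sumℚ (map g as)))

    sumℚ-nonneg : ∀ {f : A → ℚ} → (∀ a → 0ℚ ≤ f a) → ∀ as → 0ℚ ≤ sumℚ (map f as)
    sumℚ-nonneg 0≤f []       = ℚ.≤-refl
    sumℚ-nonneg 0≤f (a ∷ as) = ℚ.+-mono-≤ (0≤f a) (sumℚ-nonneg 0≤f as)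

    sumℚ-nonpos : ∀ {f : A → ℚ} → (∀ a → f a ≤ 0ℚ) → ∀ as → sumℚ (map f as) ≤ 0ℚ
    sumℚ-nonpos f≤0 []       = ℚ.≤-refl
    sumℚ-nonpos f≤0 (a ∷ as) = ℚ.+-mono-≤ (f≤0 a) (sumℚ-nonpos f≤0 as)

    sumℚ-0 : ∀ (as : List A) → sumℚ (map (const 0ℚ) as) ≡ 0ℚ
    sumℚ-0 []       = refl
    sumℚ-0 (a ∷ as) = trans (ℚ.+-identityˡ _) (sumℚ-0 as)

    -- Turns a sum over a filtered list into one over all vertices, which `∑-node` can split along
    -- the tree.
    mask : {S : Pred A 0ℓ} → Decidable S → (A → ℚ) → A → ℚ
    mask S? f a with S? a
    ... | yes _ = f a
    ... | no  _ = 0ℚ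

    sumℚ-filter : {S : Pred A 0ℓ} (S? : Decidable S) (f : A → ℚ) → ∀ as →
                  sumℚ (map f (filter S? as)) ≡ sumℚ (map (mask S? f) as)
    sumℚ-filter S? f []       = refl
    sumℚ-filter S? f (a ∷ as) with S? a
    ... | yes _ = cong (_+_ (f a)) (sumℚ-filter S? f as)
    ... | no  _ = trans (sumℚ-filter S? f as) (sym (ℚ.+-identityˡ _))

    mask-∈ : {S : Pred A 0ℓ} (S? : Decidable S) (f : A → ℚ) → ∀ {a} → S a → mask S? f a ≡ f a
    mask-∈ S? f {a} s with S? a
    ... | yes _  = refl
    ... | no ¬s = contradiction s ¬s

    mask-∉ : {S : Pred A 0ℓ} (S? : Decidable S) (f : A → ℚ) → ∀ {a} → ¬ S a → mask S? f a ≡ 0ℚ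
    mask-∉ S? f {a} ¬s with S? a
    ... | yes s = contradiction s ¬s
    ... | no _  = refl

    mask-nonneg : {S : Pred A 0ℓ} (S? : Decidable S) (f : A → ℚ) → (∀ a → 0ℚ ≤ f a) → ∀ a → 0ℚ ≤ mask S? f a
    mask-nonneg S? f 0≤f a with S? a
    ... | yes _ = 0≤f a
    ... | no _  = ℚ.≤-refl

  -- Sums over levels

  level : ∀ {T} → ℕ → (Vertex T → ℚ) → ℚ
  level          zero    f = f root
  level {node k c} (suc t) f = sumℚ (map (λ i → level {c i} t (f ∘ child i)) (allFin k))

  above : ∀ {T} → ℕ → (Vertex T → ℚ) → ℚ
  above            zero    f = 0ℚ
  above {node k c} (suc t) f = f root + sumℚ (map (λ i → above {c i} t (f ∘ child i)) (allFin k))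

  ∑-nonneg : ∀ {T} {f : Vertex T → ℚ} → (∀ v → 0ℚ ≤ f v) → 0ℚ ≤ ∑ f
  ∑-nonneg {T} 0≤f = sumℚ-nonneg 0≤f (vertices T)

  0≤q⇒p≤p+q : ∀ {p q} → 0ℚ ≤ q → p ≤ p + q
  0≤q⇒p≤p+q {p} 0≤q = ℚ.≤-trans (ℚ.≤-reflexive (sym (ℚ.+-identityʳ p))) (ℚ.+-monoʳ-≤ p 0≤q)

  -- Vertices off level `t` only add nonnegative terms to `∑ g`.
  level≤∑ : ∀ {T} t {f g : Vertex T → ℚ} → (∀ v → depth v ≡ t → f v ≤ g v) →
            (∀ v → 0ℚ ≤ g v) → level t f ≤ ∑ g
  level≤∑ {node k c} zero {f} {g} f≤g 0≤g = ℚ.≤-trans (f≤g root refl) (ℚ.≤-trans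
    (0≤q⇒p≤p+q (sumℚ-nonneg (λ i → ∑-nonneg (0≤g ∘ child i)) (allFin k)))
    (ℚ.≤-reflexive (sym (∑-node g))))
  level≤∑ {node k c} (suc t) {f} {g} f≤g 0≤g = subst₂ _≤_ (ℚ.+-identityˡ _) (sym (∑-node g))
    (ℚ.+-mono-≤ (0≤g root) (sumℚ-mono
      (λ i → level≤∑ t (λ v e → f≤g (child i v) (cong suc e)) (0≤g ∘ child i)) (allFin k)))

  above≤∑ : ∀ {T} m {f : Vertex T → ℚ} → (∀ v → 0ℚ ≤ f v) → above m f ≤ ∑ f
  above≤∑            zero    0≤f = ∑-nonneg 0≤f
  above≤∑ {node k c} (suc m) {f} 0≤f = ℚ.≤-trans
    (ℚ.+-monoʳ-≤ (f root) (sumℚ-mono (λ i → above≤∑ m (0≤f ∘ child i)) (allFin k)))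
    (ℚ.≤-reflexive (sym (∑-node f)))

  -- `above` unfolds at the root; induction on the depth needs the deepest level split off instead.
  above-suc : ∀ {T} m (f : Vertex T → ℚ) → above (suc m) f ≡ level m f + above m f
  above-suc {node k c} zero    f = cong (_+_ (f root)) (sumℚ-0 (allFin k))
  above-suc {node k c} (suc m) f = begin
    f root + sumℚ (map (λ i → above (suc m) (f ∘ child i)) (allFin k))
      ≡⟨ cong (λ ps → f root + sumℚ ps) (List.map-cong (λ i → above-suc m (f ∘ child i)) (allFin k)) ⟩
    f root + sumℚ (map (λ i → level m (f ∘ child i) + above m (f ∘ child i)) (allFin k))
      ≡⟨ cong (_+_ (f root)) (sumℚ-+ (λ i → level m (f ∘ child i)) (λ i → above m (f ∘ child i)) (allFin k)) ⟩
    f root + (level (suc m) f + sumℚ (map (λ i → above m (f ∘ child i)) (allFin k)))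
      ≡⟨ solve 3 (λ p q r → p :+ (q :+ r) :≡ q :+ (p :+ r)) refl (f root) (level (suc m) f) _ ⟩
    level (suc m) f + above (suc m) f ∎
    where
    open ≡-Reasoning

  level-mono : ∀ {T} t {f g : Vertex T → ℚ} → (∀ v → f v ≤ g v) → level t f ≤ level t g
  level-mono            zero    f≤g = f≤g root
  level-mono {node k c} (suc t) f≤g = sumℚ-mono (λ i → level-mono t (f≤g ∘ child i)) (allFin k)

  -- Residuals along paths

  -- a minus the x-weight of the path to the vertex.
  residual : ∀ {T} → ℚ → (Vertex T → ℚ) → Vertex T → ℚ
  residual a x root        = a - x root
  residual a x (child i v) = residual (a - x root) (x ∘ child i) v

  sumℚ-single : ∀ {k} (h : Fin k → ℚ) i → (∀ j → j ≢ i → h j ≤ 0ℚ) → sumℚ (map h (allFin k)) ≤ h i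
  sumℚ-single {k} h i h≤0 = subst (λ ps → sumℚ ps ≤ h i) (sym (List.map-tabulate (λ j → j) h)) (go h i h≤0)
    where
    go₀ : ∀ {k} (h : Fin k → ℚ) → (∀ j → h j ≤ 0ℚ) → sumℚ (tabulate h) ≤ 0ℚ
    go₀ {zero}  h h≤0 = ℚ.≤-refl
    go₀ {suc k} h h≤0 = ℚ.+-mono-≤ (h≤0 zero) (go₀ (h ∘ suc) (h≤0 ∘ suc))

    go : ∀ {k} (h : Fin k → ℚ) i → (∀ j → j ≢ i → h j ≤ 0ℚ) → sumℚ (tabulate h) ≤ h i
    go h zero    h≤0 = ℚ.≤-trans
      (ℚ.+-monoʳ-≤ (h zero) (go₀ (h ∘ suc) (λ j → h≤0 (suc j) λ ()))) (ℚ.≤-reflexive (ℚ.+-identityʳ _))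
    go h (suc i) h≤0 = ℚ.≤-trans
      (ℚ.+-mono-≤ (h≤0 zero λ ()) (go (h ∘ suc) i (λ j j≢i → h≤0 (suc j) λ { refl → j≢i refl })))
      (ℚ.≤-reflexive (ℚ.+-identityˡ _))

  ∑-nonpos : ∀ {T} {f : Vertex T → ℚ} → (∀ v → f v ≤ 0ℚ) → ∑ f ≤ 0ℚ
  ∑-nonpos {T} f≤0 = sumℚ-nonpos f≤0 (vertices T)

  root∈path : ∀ {T} (v : Vertex T) → root ∈ path v
  root∈path root        = here refl
  root∈path (child i v) = here refl

  ∈-path-child⇒≡ : ∀ {T} {i j : Fin (arity T)} {u : Vertex (subtree T j)} {v : Vertex (subtree T i)} →
                   child {T} j u ∈ path (child {T} i v) → j ≡ i
  ∈-path-child⇒≡ (there p) with ∈-map⁻ (child _) p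
  ... | _ , _ , refl = refl

  -- At each vertex only the child on the path can contribute positively to `∑ g`. The function `g`
  -- is general because a mask restricted to a child's subtree is not literally a mask, and `a`
  -- because it drops to `a - x root` there.
  residual-path : ∀ {T} a (x g : Vertex T → ℚ) v →
                  (∀ u → u ∈ path v → g u ≤ x u) → (∀ u → ¬ u ∈ path v → g u ≤ 0ℚ) →
                  residual a x v + ∑ g ≤ a
  residual-path {node k c} a x g root ∈⇒ ∉⇒ = begin
    (a - x root) + ∑ g            ≡⟨ cong (_+_ (a - x root)) (∑-node g) ⟩
    (a - x root) + (g root + sumℚ (map (λ i → ∑ (g ∘ child i)) (allFin k)))
      ≤⟨ ℚ.+-monoʳ-≤ (a - x root) (ℚ.+-mono-≤ (∈⇒ root (here refl))
          (sumℚ-nonpos (λ i → ∑-nonpos (λ v → ∉⇒ (child i v) λ { (here ()) ; (there ()) })) (allFin k))) ⟩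
    (a - x root) + (x root + 0ℚ)  ≡⟨ solve 2 (λ p q → (p :- q) :+ (q :+ con 0ℚ) :≡ p) refl a (x root) ⟩
    a ∎
    where
    open ℚ.≤-Reasoning
  residual-path {node k c} a x g (child i v) ∈⇒ ∉⇒ = begin
    r + ∑ g                        ≡⟨ cong (_+_ r) (∑-node g) ⟩
    r + (g root + sumℚ (map (λ i → ∑ (g ∘ child i)) (allFin k)))
      ≤⟨ ℚ.+-monoʳ-≤ r (ℚ.+-mono-≤ (∈⇒ root (here refl)) (sumℚ-single (λ j → ∑ (g ∘ child j)) i
          (λ j j≢i → ∑-nonpos (λ u → ∉⇒ (child j u) (j≢i ∘ ∈-path-child⇒≡))))) ⟩
    r + (x root + ∑ (g ∘ child i)) ≡⟨ solve 3 (λ p q s → p :+ (q :+ s) :≡ q :+ (p :+ s)) refl r (x root) (∑ (g ∘ child i)) ⟩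
    x root + (r + ∑ (g ∘ child i))
      ≤⟨ ℚ.+-monoʳ-≤ (x root) (residual-path (a - x root) (x ∘ child i) (g ∘ child i) v
          (λ u u∈ → ∈⇒ (child i u) (there (∈-map⁺ (child i) u∈)))
          (λ u u∉ → ∉⇒ (child i u) λ { (there q) → u∉ (∈-child⁻ q) })) ⟩
    x root + (a - x root)          ≡⟨ solve 2 (λ p q → q :+ (p :- q) :≡ p) refl a (x root) ⟩
    a ∎
    where
    open ℚ.≤-Reasoning
    r = residual (a - x root) (x ∘ child i) v

    ∈-child⁻ : ∀ {u} → child i u ∈ map (child i) (path v) → u ∈ path v
    ∈-child⁻ q with ∈-map⁻ (child i) q
    ... | _ , u∈ , refl = u∈

  -- The least depth of a vertex with at most one child, as long as no vertex has more
  -- than two; a vertex with three or more children counts as an exit, too.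
  exitDepth : Tree → ℕ
  exitDepth (node 2 c) = suc (exitDepth (c zero) ℕ.⊓ exitDepth (c (suc zero)))
  exitDepth (node _ c) = 0

  -- At depths less than `exitDepth T` every vertex has exactly two children, and a child's residual
  -- plus its own `x` is the residual of its parent, which is thus counted twice.
  level-residual : ∀ {T} t a (x : Vertex T → ℚ) → t ℕ.< exitDepth T →
                   level (suc t) (residual a x) + level (suc t) x ≡ level t (residual a x) + level t (residual a x)
  level-residual {node 2 c} zero a x t<h =
    solve 4 (λ a p q r → (((a :- p) :- q) :+ (((a :- p) :- r) :+ con 0ℚ)) :+ (q :+ (r :+ con 0ℚ)) :≡ (a :- p) :+ (a :- p))
      refl a (x root) (x (child zero root)) (x (child (suc zero) root))
  level-residual {node 2 c} (suc t) a x (s≤s t<h) =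
    trans (solve 4 (λ p q r s → (p :+ (q :+ con 0ℚ)) :+ (r :+ (s :+ con 0ℚ)) :≡ (p :+ r) :+ (q :+ s)) refl
            (level (suc t) (residual _ (x ∘ child zero))) (level (suc t) (residual _ (x ∘ child (suc zero))))
            (level (suc t) (x ∘ child zero)) (level (suc t) (x ∘ child (suc zero))))
    (trans (cong₂ _+_ (level-residual t _ (x ∘ child zero) (ℕ.≤-trans t<h (ℕ.m⊓n≤m _ _)))
                      (level-residual t _ (x ∘ child (suc zero)) (ℕ.≤-trans t<h (ℕ.m⊓n≤n _ _))))
           (solve 2 (λ p q → (p :+ p) :+ (q :+ q) :≡ (p :+ (q :+ con 0ℚ)) :+ (p :+ (q :+ con 0ℚ))) refl
             (level t (residual (a - x root) (x ∘ child zero))) (level t (residual (a - x root) (x ∘ child (suc zero))))))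

  -- Counting in the rationals

  /1-suc : ∀ n → (+ suc n) / 1 ≡ 1ℚ + (+ n) / 1
  /1-suc n = sym (trans (cong (_+_ 1ℚ) (ℚ.↥p/↧p≡p (fromℤ (+ n))))
    (ℚ./-cong {q₁ = 1} {q₂ = 1} (cong (ℤ._+_ (+ 1)) (ℤ.*-identityʳ (+ n))) refl))

  /1-+ : ∀ m n → (+ (m ℕ.+ n)) / 1 ≡ (+ m) / 1 + (+ n) / 1
  /1-+ zero    n = sym (ℚ.+-identityˡ _)
  /1-+ (suc m) n = trans (/1-suc (m ℕ.+ n)) (trans (cong (_+_ 1ℚ) (/1-+ m n))
    (trans (sym (ℚ.+-assoc 1ℚ ((+ m) / 1) ((+ n) / 1))) (cong (_+ (+ n) / 1) (sym (/1-suc m)))))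

  /1-nonneg : ∀ n → 0ℚ ≤ (+ n) / 1
  /1-nonneg n = ℚ.nonNegative⁻¹ _ {{ℚ.normalize-nonNeg n 1}}

  /1-mono : ∀ {m n} → m ℕ.≤ n → (+ m) / 1 ≤ (+ n) / 1
  /1-mono {m} {n} m≤n = subst (λ n → (+ m) / 1 ≤ (+ n) / 1) (ℕ.m+[n∸m]≡n m≤n)
    (ℚ.≤-trans (0≤q⇒p≤p+q (/1-nonneg (n ℕ.∸ m))) (ℚ.≤-reflexive (sym (/1-+ m (n ℕ.∸ m)))))

  sumℚ-1- : ∀ {A : Set} (f : A → ℚ) as →
              sumℚ (map f as) + sumℚ (map (λ a → 1ℚ - f a) as) ≡ (+ length as) / 1
  sumℚ-1- f []       = refl
  sumℚ-1- f (a ∷ as) = trans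
    (solve 3 (λ p q r → (p :+ q) :+ ((con 1ℚ :- p) :+ r) :≡ con 1ℚ :+ (q :+ r)) refl (f a) (sumℚ (map f as)) _)
    (trans (cong (_+_ 1ℚ) (sumℚ-1- f as)) (sym (/1-suc (length as))))

  -- Consequences of feasibility

  module _ {T x y} (feasible : Feasible T x y) where
    open Feasible feasible

    -- Hartke's constraint at the source ranges over the whole level and the source itself, whose
    -- weight is nonnegative.
    level≤1 : ∀ t → level (suc t) x ≤ 1ℚ
    level≤1 t = ℚ.≤-trans
      (level≤∑ (suc t)
        (λ v e → ℚ.≤-reflexive (sym (mask-∈ S? x (inj₂ (root∈path v , e)))))
        (mask-nonneg S? x (proj₁ ∘ x-unit)))
      (subst (_≤ 1ℚ) (sumℚ-filter S? x (vertices T)) (hartke root (suc t) (s≤s z≤n)))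
      where S? = P? root ∪? (below? root ∩? L? (suc t))

    -- The residual and the weight of the path sum to at most `1`, and `cover` bounds that weight
    -- below by `y v`.
    residual≤1-y : ∀ v → residual 1ℚ x v ≤ 1ℚ - y v
    residual≤1-y v = begin
      r                ≡⟨ solve 2 (λ p q → p :≡ (p :+ q) :- q) refl r s ⟩
      (r + s) - s      ≤⟨ ℚ.+-mono-≤ (residual-path 1ℚ x (mask (P? v) x) v
                            (λ u u∈ → ℚ.≤-reflexive (mask-∈ (P? v) x u∈))
                            (λ u u∉ → ℚ.≤-reflexive (mask-∉ (P? v) x u∉)))
                            (ℚ.neg-antimono-≤ (subst (y v ≤_) (sumℚ-filter (P? v) x (vertices T)) (cover v))) ⟩
      1ℚ - y v ∎
      where
      open ℚ.≤-Reasoning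
      r = residual 1ℚ x v
      s = ∑ (mask (P? v) x)

    1≤level-residual : ∀ t → t ℕ.≤ exitDepth T → 1ℚ ≤ level t (residual 1ℚ x)
    -- The source carries no weight, so its residual is `1`.
    1≤level-residual zero    _   rewrite source = ℚ.≤-refl
    1≤level-residual (suc t) t<h = begin
      1ℚ + 1ℚ - 1ℚ            ≤⟨ ℚ.+-mono-≤ (ℚ.+-mono-≤ ih ih) (ℚ.neg-antimono-≤ (level≤1 t)) ⟩
      Qₜ + Qₜ - X             ≡⟨ cong (_- X) (sym (level-residual t 1ℚ x t<h)) ⟩
      (Q + X) - X             ≡⟨ solve 2 (λ p q → (p :+ q) :- q :≡ p) refl Q X ⟩
      Q ∎
      where
      open ℚ.≤-Reasoning
      ih = 1≤level-residual t (ℕ.<⇒≤ t<h)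
      Qₜ = level t (residual 1ℚ x)
      Q  = level (suc t) (residual 1ℚ x)
      X  = level (suc t) x

    above-bound : ∀ m → m ℕ.≤ suc (exitDepth T) → (+ m) / 1 ≤ above m (λ v → 1ℚ - y v)
    above-bound zero    _         = ℚ.≤-refl
    above-bound (suc m) (s≤s m≤h) = subst₂ _≤_ (sym (/1-suc m)) (sym (above-suc m _))
      (ℚ.+-mono-≤ (ℚ.≤-trans (1≤level-residual m m≤h) (level-mono m residual≤1-y))
                  (above-bound m (ℕ.m≤n⇒m≤1+n m≤h)))

    -- Here `s` counts saved and `m` burnt vertices: the terms `1 - y v` sum to at least `m`, which
    -- leaves at most `s` for `y`.
    ∑y-bound : ∀ {s m} → m ℕ.≤ suc (exitDepth T) → length (vertices T) ℕ.≤ s ℕ.+ m → ∑ y ≤ (+ s) / 1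
    ∑y-bound {s} {m} m≤ n≤s+m = begin
      ∑ y                     ≡⟨ solve 2 (λ p q → p :≡ (p :+ q) :- q) refl (∑ y) C ⟩
      ∑ y + C - C             ≤⟨ ℚ.+-mono-≤ (ℚ.≤-reflexive (sumℚ-1- y (vertices T))) (ℚ.neg-antimono-≤
                                   (ℚ.≤-trans (above-bound m m≤) (above≤∑ m 0≤1-y))) ⟩
      (+ length (vertices T)) / 1 - M  ≤⟨ ℚ.+-monoˡ-≤ (- M) (/1-mono n≤s+m) ⟩
      (+ (s ℕ.+ m)) / 1 - M   ≡⟨ cong (_- M) (/1-+ s m) ⟩
      (+ s) / 1 + M - M       ≡⟨ solve 2 (λ p q → (p :+ q) :- q :≡ p) refl ((+ s) / 1) M ⟩
      (+ s) / 1 ∎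
      where
      open ℚ.≤-Reasoning
      C = ∑ (λ v → 1ℚ - y v)
      M = (+ m) / 1

      0≤1-y : ∀ v → 0ℚ ≤ 1ℚ - y v
      0≤1-y v = ℚ.+-monoʳ-≤ 1ℚ (ℚ.neg-antimono-≤ (proj₂ (y-unit v)))

-- Strategies along a descent

open LinearProgram using (exitDepth; ∑y-bound; root∈path)
open import Data.Nat.Base using (_+_; _*_; _^_; _⊓_)

-- The way of the fire through vertices with exactly two children. It grows at its lower end, as the
-- search does.
data Descent (T : Tree) : ℕ → Tree → Set where
  here : Descent T 0 T
  step : ∀ {t c} (i : Fin 2) → Descent T t (node 2 c) → Descent T (suc t) (c i)

extend : ∀ {T t S} → Descent T t S → Strategy S → Strategy T
extend here       σ = σ
extend (step i d) σ = extend d (child (opposite i) root ∷ map (child i) σ)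

-- `miss` carries no refutation, so the index only bounds the number of failures from above.
data AllBut {A : Set} (P : Pred A 0ℓ) : List A → ℕ → Set where
  []   : AllBut P [] 0
  hit  : ∀ {a as m} → P a → AllBut P as m → AllBut P (a ∷ as) m
  miss : ∀ {a as m} → AllBut P as m → AllBut P (a ∷ as) (suc m)

module _ {A : Set} {P : Pred A 0ℓ} where

  ++-AllBut : ∀ {as bs m n} → AllBut P as m → AllBut P bs n → AllBut P (as ++ bs) (m + n)
  ++-AllBut []        q = q
  ++-AllBut (hit p b) q = hit p (++-AllBut b q)
  ++-AllBut (miss b)  q = miss (++-AllBut b q)

  all-AllBut : (∀ a → P a) → ∀ as → AllBut P as 0
  all-AllBut p []       = []
  all-AllBut p (a ∷ as) = hit (p a) (all-AllBut p as)

  map-AllBut : ∀ {B : Set} {Q : Pred B 0ℓ} (f : A → B) → (∀ {a} → P a → Q (f a)) →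
               ∀ {as m} → AllBut P as m → AllBut Q (map f as) m
  map-AllBut f P⇒Q []        = []
  map-AllBut f P⇒Q (hit p b) = hit (P⇒Q p) (map-AllBut f P⇒Q b)
  map-AllBut f P⇒Q (miss b)  = miss (map-AllBut f P⇒Q b)

  length≤filter : (P? : Decidable P) → ∀ {as m} → AllBut P as m →
                  length as ℕ.≤ length (filter P? as) + m
  length≤filter P? []        = z≤n
  length≤filter P? (hit {a} p b) with P? a
  ... | yes _ = s≤s (length≤filter P? b)
  ... | no ¬p = contradiction p ¬p
  length≤filter P? (miss {a} {as} {m} b) with P? a
  ... | yes _ = s≤s (ℕ.≤-trans (length≤filter P? b) (ℕ.+-monoʳ-≤ _ (ℕ.n≤1+n m)))
  ... | no  _ = ℕ.≤-trans (s≤s (length≤filter P? b)) (ℕ.≤-reflexive (sym (ℕ.+-suc _ m)))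

module _ {T : Tree} where

  -- The new pick delays the others by one, and the child's vertices lie one deeper in `T`, so every
  -- deadline is still met.
  Saved-child : ∀ {i σ v} u → Saved σ v → Saved (u ∷ map (child {T} i) σ) (child i v)
  Saved-child {i} {σ} u s = there (Any.map⁺ (Any.map (λ {w} w∈ → there
    (subst (child i w ∈_) (sym (List.take-map (depth w) σ)) (∈-map⁺ (child i) w∈))) s))

  Saved-below : ∀ {i σ} v → Saved (child {T} i root ∷ σ) (child i v)
  Saved-below {i} v = there (Any.map⁺ (Any.map (λ { refl → here refl }) (root∈path v)))

Burns : ∀ {T} → Strategy T → ℕ → Set
Burns {T} σ m = AllBut (Saved σ) (vertices T) m

-- Only the root is lost in addition: the first pick saves the sibling's whole subtree, and `σ` acts
-- on the other one.
burns-step : ∀ {c m} (i : Fin 2) {σ : Strategy (c i)} → Burns σ m →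
             Burns {node 2 c} (child (opposite i) root ∷ map (child i) σ) (suc m)
burns-step {m = m} zero b = miss (subst (AllBut _ _) (ℕ.+-identityʳ m) (++-AllBut
  (map-AllBut (child zero) (Saved-child _) b)
  (++-AllBut (map-AllBut (child (suc zero)) id (all-AllBut Saved-below _)) [])))
burns-step {c} {m} (suc zero) b = miss (subst (AllBut _ _) (ℕ.+-identityʳ m) (++-AllBut
  (map-AllBut (child zero) id (all-AllBut Saved-below (vertices (c zero))))
  (++-AllBut (map-AllBut (child (suc zero)) (Saved-child _) b) [])))

burns-extend : ∀ {T t S σ m} (d : Descent T t S) → Burns σ m → Burns (extend d σ) (t + m)
burns-extend here b = b
burns-extend {t = suc t} {m = m} (step i d) b =
  subst (Burns _) (ℕ.+-suc t m) (burns-extend d (burns-step i b))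

-- The empty strategy is meant for a leaf; for two or more children it is a mere default.
endgame : ∀ T → Strategy T
endgame (node 1 c) = child zero root ∷ []
endgame (node _ c) = []

burns-endgame : ∀ T → arity T ℕ.≤ 1 → Burns (endgame T) 1
burns-endgame (node 0 c) _ = miss []
burns-endgame (node 1 c) _ = miss (++-AllBut (map-AllBut (child zero) id (all-AllBut Saved-below _)) [])
burns-endgame (node (suc (suc _)) c) (s≤s ())

-- Vertex codes relative to the whole tree

-- The index of the sibling is stored next to that of the child, so that climbing
-- needs no case distinction.
trail : ∀ {T t S} → Descent T t S → Datum
trail here       = nil
trail (step i d) = (unary (toℕ i) ∙ unary (toℕ (opposite i))) ∙ trail d

-- Turns the code of a vertex of S into the code of the same vertex of T.
place : ∀ {T t S} → Descent T t S → Datum → Datum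
place here       e = e
place (step i d) e = place d (unary (toℕ i) ∙ e)

-- The accumulator of the climb: picks already carry their codes in `T`, so moving up a level does
-- not rewrite them.
placeAll : ∀ {T t S} → Descent T t S → Strategy S → Datum
placeAll d σ = encodeList (map (place d ∘ encodeVertex) σ)

placeAll-step : ∀ {T t c} (i : Fin 2) (d : Descent T t (node 2 c)) σ →
                placeAll d (map (child i) σ) ≡ placeAll (step i d) σ
placeAll-step i d σ = cong encodeList (sym (List.map-∘ σ))

size-unary : ∀ (i : Fin 2) → size (unary (toℕ i)) ℕ.≤ 3
size-unary zero       = s≤s z≤n
size-unary (suc zero) = s≤s (s≤s (s≤s z≤n))

-- Each step prefixes one cell and an index of size at most 3, hence the factor 4.
size-place : ∀ {T t S} (d : Descent T t S) e → size (place d e) ℕ.≤ 4 * t + size e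
size-place here       e = ℕ.≤-refl
size-place {t = suc t} (step i d) e = begin
  size (place d (unary (toℕ i) ∙ e))   ≤⟨ size-place d _ ⟩
  4 * t + suc (size (unary (toℕ i)) + size e)  ≤⟨ ℕ.+-monoʳ-≤ (4 * t) (s≤s (ℕ.+-monoˡ-≤ (size e) (size-unary i))) ⟩
  4 * t + suc (3 + size e)             ≡⟨ solve 2 (λ t n → con 4 :* t :+ (con 4 :+ n) :≡ con 4 :* (con 1 :+ t) :+ n)
                                              refl t (size e) ⟩
  4 * suc t + size e ∎
  where
  open ℕ.≤-Reasoning
  open ℕ-Solver using (solve; con; _:+_; _:*_) renaming (_:=_ to _:≡_)

-- The program

pattern acc   = zero
pattern cur   = suc zero
pattern next  = suc (suc zero)
pattern trl   = suc (suc (suc zero))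
pattern rest  = suc (suc (suc (suc zero)))
pattern code  = suc (suc (suc (suc (suc zero))))

one : Expr 6
one = cons nil nil

subtrees : Expr 6
subtrees = tl (hd (var cur))

-- cur and next hold the unvisited vertices of the current level and the vertices
-- found so far of the next one, each as its trail paired with its subtree. The loop
-- stops at the first vertex with at most one child.
search : Cmd 6
search =
  while tl subtrees run
    (next := cons (cons (cons (cons nil one) (hd (hd (var cur)))) (hd subtrees))
            (cons (cons (cons (cons one nil) (hd (hd (var cur)))) (hd (tl subtrees))) (var next))
    ⨾ cur := tl (var cur)
    ⨾ (if var cur then skip else (cur := var next ⨾ next := nil)))

-- A trail starts with its deepest step, so prefixing its indices one by one orders the code from
-- the root. A copy is consumed because the climb still needs `trl`.
emit : Cmd 6
emit =
  rest := var trl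
  ⨾ (while var rest run
      (code := cons (hd (hd (var rest))) (var code)
      ⨾ rest := tl (var rest)))
  ⨾ acc := cons (var code) (var acc)

-- Siblings are met from the deepest up and each is prefixed, so the shallowest becomes the first
-- pick.
climb : Cmd 6
climb =
  while var trl run
    (code := cons (tl (hd (var trl))) nil
    ⨾ trl := tl (var trl)
    ⨾ emit)

firefighter : Program
firefighter = program
  ( cur := cons (cons nil (hd (var acc))) nil
  ⨾ search
  ⨾ trl := hd (hd (var cur))
  ⨾ acc := nil
  -- `one` doubles as the code of the only child, `child zero root`.
  ⨾ (if subtrees then (code := one ⨾ emit) else skip)
  ⨾ climb )

-- Running times of the output loops

reverse-runs : ∀ {T t S} (d : Descent T t S) {a u n r w} →
  (while var rest run (code := cons (hd (hd (var rest))) (var code) ⨾ rest := tl (var rest)))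
    , (a ∷ u ∷ n ∷ r ∷ trail d ∷ w ∷ []) ⇓[ t * 11 + 2 ]
      (a ∷ u ∷ n ∷ r ∷ nil ∷ place d w ∷ [])
reverse-runs here       = while-stop refl
-- A round takes 2 steps for the test and 6 and 3 for the assignments.
reverse-runs (step i d) = while-step (λ ()) (seq assign assign) (reverse-runs d)

emit-runs : ∀ {T t S} (d : Descent T t S) {a u n r w} →
  emit , (a ∷ u ∷ n ∷ trail d ∷ r ∷ w ∷ []) ⇓[ 2 + (t * 11 + 2 + 4) ]
    ((place d w ∙ a) ∷ u ∷ n ∷ trail d ∷ nil ∷ place d w ∷ [])
emit-runs d = seq assign (seq (reverse-runs d) assign)

-- Time and output size are bounded together: a round pays for its steps and for the code it adds,
-- both linear in the depth.
climb-runs : ∀ {T t S} (d : Descent T t S) (σ : Strategy S) {u n r w} →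
  ∃[ ρ ] ∃[ s ] (climb , (placeAll d σ ∷ u ∷ n ∷ trail d ∷ r ∷ w ∷ []) ⇓[ s ]
                  (encodeStrategy (extend d σ) ∷ ρ))
              × s + size (encodeStrategy (extend d σ)) ℕ.≤ t * (t * 8 + 17) + 2 + size (placeAll d σ)
climb-runs here       σ = _ , _ , while-stop refl , ℕ.≤-refl
climb-runs {t = suc t} (step i d) σ {u} {n} {r} {w}
  with ρ , s , climbs , s≤ ← climb-runs d (child (opposite i) root ∷ map (child i) σ) {u} {n}
                               {nil} {place d (unary (toℕ (opposite i)) ∙ nil)}
  rewrite placeAll-step i d σ =
  ρ , _ , while-step (λ ()) (seq assign (seq assign (emit-runs d))) climbs , bound
  where
  open ℕ.≤-Reasoning
  open ℕ-Solver using (solve; con; _:+_; _:*_) renaming (_:=_ to _:≡_)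
  sibling = place d (unary (toℕ (opposite i)) ∙ nil)
  out     = size (encodeStrategy (extend d (child (opposite i) root ∷ map (child i) σ)))
  old     = size (placeAll (step i d) σ)

  sibling≤ : size sibling ℕ.≤ 4 * t + 5
  sibling≤ = ℕ.≤-trans (size-place d _) (ℕ.+-monoʳ-≤ (4 * t) (s≤s (ℕ.+-monoˡ-≤ 1 (size-unary (opposite i)))))

  bound : suc (1 + (6 + (3 + (2 + (t * 11 + 2 + 4)))) + s) + out ℕ.≤ suc t * (suc t * 8 + 17) + 2 + old
  bound = begin
    suc (1 + (6 + (3 + (2 + (t * 11 + 2 + 4)))) + s) + out
      ≡⟨ solve 3 (λ t s o → con 1 :+ (con 1 :+ (con 6 :+ (con 3 :+ (con 2 :+ (t :* con 11 :+ con 2 :+ con 4)))) :+ s) :+ o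
                         :≡ con 11 :* t :+ con 19 :+ (s :+ o)) refl t s out ⟩
    11 * t + 19 + (s + out)
      ≤⟨ ℕ.+-monoʳ-≤ (11 * t + 19) s≤ ⟩
    11 * t + 19 + (t * (t * 8 + 17) + 2 + suc (size sibling + old))
      ≤⟨ ℕ.+-monoʳ-≤ (11 * t + 19) (ℕ.+-monoʳ-≤ (t * (t * 8 + 17) + 2) (s≤s (ℕ.+-monoˡ-≤ old sibling≤))) ⟩
    11 * t + 19 + (t * (t * 8 + 17) + 2 + suc (4 * t + 5 + old))
      -- The extra `t` raises the round's `15 * t + 25` to `16 * t + 25`, the increment of
      -- `t * (t * 8 + 17)`.
      ≤⟨ ℕ.m≤m+n _ t ⟩
    11 * t + 19 + (t * (t * 8 + 17) + 2 + suc (4 * t + 5 + old)) + t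
      ≡⟨ solve 2 (λ t o → con 11 :* t :+ con 19 :+ (t :* (t :* con 8 :+ con 17) :+ con 2 :+
                                    (con 1 :+ (con 4 :* t :+ con 5 :+ o))) :+ t
                       :≡ (con 1 :+ t) :* ((con 1 :+ t) :* con 8 :+ con 17) :+ con 2 :+ o) refl t old ⟩
    suc t * (suc t * 8 + 17) + 2 + old ∎

-- Breadth-first search

Item : Tree → ℕ → Set
Item T t = Σ[ S ∈ Tree ] Descent T t S

encodeItem : ∀ {T t} → Item T t → Datum
encodeItem (S , d) = trail d ∙ encodeTree S

encodeItems : ∀ {T t} → List (Item T t) → Datum
encodeItems is = encodeList (map encodeItem is)

weight : ∀ {T t} → List (Item T t) → ℕ
weight is = sum (map (size ∘ encodeTree ∘ proj₁) is)

AtMostBinary : Tree → Set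
AtMostBinary T = (v : Vertex T) → childCount v ℕ.≤ 2

descend : ∀ {T t S} → Descent T t S → AtMostBinary T → AtMostBinary S
descend here       b = b
descend (step i d) b = descend d b ∘ child i

Within : ∀ {T t} → ℕ → Item T t → Set
Within {t = t} h (S , d) = t + exitDepth S ℕ.≤ h

child-within : ∀ {T t h c} (d : Descent T t (node 2 c)) → Within h (node 2 c , d) →
               Within h (c zero , step zero d) ⊎ Within h (c (suc zero) , step (suc zero) d)
child-within {t = t} {h} {c} d p = Sum.map step-within step-within (ℕ.⊓-sel (exitDepth (c zero)) _)
  where
  step-within : ∀ {n} → exitDepth (c zero) ⊓ exitDepth (c (suc zero)) ≡ n → suc t + n ℕ.≤ h
  step-within refl = subst (ℕ._≤ h) (ℕ.+-suc t _) p

-- The search invariant: an exit of depth at most `h` in `T` still lies under some waiting vertex.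
Frontier : ∀ {T t} → ℕ → List (Item T t) → List (Item T (suc t)) → Set
Frontier h is js = Any (Within h) is ⊎ Any (Within h) js

next-level : ∀ {T t h} {js : List (Item T (suc t))} → Frontier h [] js → Frontier h js []
next-level (inj₂ p) = inj₁ p

frontier⇒≤ : ∀ {T t h} (is : List (Item T t)) js → Frontier h is js → t ℕ.≤ h
frontier⇒≤ _ _ (inj₁ p) = ℕ.m+n≤o⇒m≤o _ (proj₂ (Any.satisfied p))
frontier⇒≤ _ _ (inj₂ p) = ℕ.<⇒≤ (ℕ.m+n≤o⇒m≤o _ (proj₂ (Any.satisfied p)))

children : ∀ {T t c} → Descent T t (node 2 c) → List (Item T (suc t)) → List (Item T (suc t))
children d js = (_ , step zero d) ∷ (_ , step (suc zero) d) ∷ js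

frontier-step : ∀ {T t c h} {d : Descent T t (node 2 c)} {is js} →
                Frontier h ((_ , d) ∷ is) js → Frontier h is (children d js)
frontier-step {d = d} (inj₁ (here p)) with child-within d p
... | inj₁ q = inj₂ (here q)
... | inj₂ q = inj₂ (there (here q))
frontier-step (inj₁ (there p)) = inj₁ p
frontier-step (inj₂ p)         = inj₂ (there (there p))

-- The code of a vertex with two children has three nodes beyond the codes of its subtrees, so the
-- weight falls at every visit and bounds the number of rounds.
weight-step : ∀ {T t c} {d : Descent T t (node 2 c)} is js →
              suc (weight is + weight (children d js)) ℕ.≤ weight ((_ , d) ∷ is) + weight js
weight-step {c = c} is js = begin
  suc (weight is + (l + (r + weight js)))
    ≤⟨ ℕ.m≤m+n _ 2 ⟩
  suc (weight is + (l + (r + weight js))) + 2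
    ≡⟨ solve 4 (λ l r i j → con 1 :+ (i :+ (l :+ (r :+ j))) :+ con 2
                         :≡ con 1 :+ (l :+ (con 1 :+ (r :+ con 1))) :+ i :+ j) refl l r (weight is) (weight js) ⟩
  suc (l + suc (r + 1)) + weight is + weight js ∎
  where
  open ℕ.≤-Reasoning
  open ℕ-Solver using (solve; con; _:+_; _:*_) renaming (_:=_ to _:≡_)
  l = size (encodeTree (c zero))
  r = size (encodeTree (c (suc zero)))

module _ {T : Tree} (binary : AtMostBinary T) where

  SearchRuns : ∀ {t} → ℕ → ℕ → List (Item T t) → List (Item T (suc t)) → Set
  SearchRuns h k is js = ∀ {a} →
    Σ[ t ∈ ℕ ] Σ[ S ∈ Tree ] Σ[ d ∈ Descent T t S ] ∃[ q ] ∃[ n ] ∃[ s ]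
      (search , (a ∷ encodeItems is ∷ encodeItems js ∷ nil ∷ nil ∷ nil ∷ [])
         ⇓[ s ] (a ∷ (encodeItem (S , d) ∙ q) ∷ n ∷ nil ∷ nil ∷ nil ∷ []))
      × t ℕ.≤ h × arity S ℕ.≤ 1 × s ℕ.≤ k * 60 + 60

  -- `k` bounds the remaining weight and serves as fuel. The step count of a round is a numeral,
  -- checked by evaluation to be at most 60.
  search-runs : ∀ {h} k {t} i is (js : List (Item T (suc t))) →
    weight (i ∷ is) + weight js ℕ.≤ k → Frontier h (i ∷ is) js → SearchRuns h k (i ∷ is) js
  search-runs k (node 0 c , d) is js _ f =
    _ , _ , d , _ , _ , _ , while-stop refl , frontier⇒≤ (_ ∷ is) js f , z≤n , ℕ.m≤n⇒m≤o+n (k * 60) (ℕ.≤ᵇ⇒≤ _ 60 tt)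
  search-runs k (node 1 c , d) is js _ f =
    _ , _ , d , _ , _ , _ , while-stop refl , frontier⇒≤ (_ ∷ is) js f , s≤s z≤n , ℕ.m≤n⇒m≤o+n (k * 60) (ℕ.≤ᵇ⇒≤ _ 60 tt)
  search-runs k (node (suc (suc (suc _))) c , d) is js _ f with s≤s (s≤s ()) ← descend d binary root
  search-runs (suc k) (node 2 c , d) (i ∷ is) js w f
    with t , S , d′ , q , n , s , halts , t≤h , S≤1 , s≤ ←
      search-runs k i is (children d js) (ℕ.≤-pred (ℕ.≤-trans (weight-step {d = d} (i ∷ is) js) w)) (frontier-step f)
    = t , S , d′ , q , n , _
    , while-step (λ ()) (seq assign (seq assign (if-true (λ ()) skip))) halts
    , t≤h , S≤1 , ℕ.+-mono-≤ (ℕ.≤ᵇ⇒≤ _ 60 tt) s≤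
  -- The level is exhausted; the next one contains the two children just found, so it is not empty.
  search-runs (suc k) (node 2 c , d) [] js w f
    with t , S , d′ , q , n , s , halts , t≤h , S≤1 , s≤ ←
      search-runs k _ (_ ∷ js) [] (ℕ.≤-pred
        (ℕ.≤-trans (ℕ.≤-reflexive (cong suc (ℕ.+-identityʳ _))) (ℕ.≤-trans (weight-step {d = d} [] js) w)))
        (next-level (frontier-step f))
    = t , S , d′ , q , n , _
    , while-step (λ ()) (seq assign (seq assign (if-false refl (seq assign assign)))) halts
    , t≤h , S≤1 , ℕ.+-mono-≤ (ℕ.≤ᵇ⇒≤ _ 60 tt) s≤

-- The last pick

endgame-runs : ∀ {T t S} (d : Descent T t S) → arity S ℕ.≤ 1 → ∀ {q n} →
  ∃[ r ] ∃[ w ] ∃[ s ]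
    ((if subtrees then (code := one ⨾ emit) else skip)
      , (nil ∷ (encodeItem (S , d) ∙ q) ∷ n ∷ trail d ∷ nil ∷ nil ∷ [])
      ⇓[ s ] (placeAll d (endgame S) ∷ (encodeItem (S , d) ∙ q) ∷ n ∷ trail d ∷ r ∷ w ∷ []))
    × s + size (placeAll d (endgame S)) ℕ.≤ 15 * t + 21
endgame-runs {t = t} {node 0 c} d _ = _ , _ , _ , if-false refl skip , ℕ.m≤n⇒m≤o+n (15 * t) (ℕ.≤ᵇ⇒≤ 6 21 tt)
endgame-runs {t = t} {node 1 c} d _ = _ , _ , _ , if-true (λ ()) (seq assign (emit-runs d)) , (begin
  suc (3 + (4 + (2 + (t * 11 + 2 + 4)))) + suc (size (place d (nil ∙ nil)) + 1)
    ≤⟨ ℕ.+-monoʳ-≤ (suc (3 + (4 + (2 + (t * 11 + 2 + 4))))) (s≤s (ℕ.+-monoˡ-≤ 1 (size-place d (nil ∙ nil)))) ⟩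
  suc (3 + (4 + (2 + (t * 11 + 2 + 4)))) + suc (4 * t + 3 + 1)
    ≡⟨ solve 1 (λ t → con 10 :+ (t :* con 11 :+ con 2 :+ con 4) :+ (con 1 :+ (con 4 :* t :+ con 3 :+ con 1))
                   :≡ con 15 :* t :+ con 21) refl t ⟩
  15 * t + 21 ∎)
  where
  open ℕ.≤-Reasoning
  open ℕ-Solver using (solve; con; _:+_; _:*_) renaming (_:=_ to _:≡_)
endgame-runs {S = node (suc (suc _)) c} d (s≤s ())

-- Total time and conclusion

exitDepth≤size : ∀ T → exitDepth T ℕ.≤ size (encodeTree T)
exitDepth≤size (node 0 c) = z≤n
exitDepth≤size (node 1 c) = z≤n
exitDepth≤size (node 2 c) = s≤s (ℕ.≤-trans (ℕ.m⊓n≤m _ _) (ℕ.m≤n⇒m≤n+o _ (exitDepth≤size (c zero))))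
exitDepth≤size (node (suc (suc (suc _))) c) = z≤n

maxDegree⇒binary : ∀ {T} → MaxDegree≤ 3 T → degree {T} root ≡ 2 → AtMostBinary T
maxDegree⇒binary Δ≤3 root₂ root        = ℕ.≤-reflexive root₂
maxDegree⇒binary Δ≤3 root₂ (child i v) = ℕ.≤-pred (Δ≤3 (child i v))

-- The constants 7, 4 and 2 are the costs of the assignments around the search. The size `p` of the
-- accumulator before the climb cancels between the last two hypotheses.
time-bound : ∀ {N t s₁ s₂ s₃ p o} .{{_ : ℕ.NonZero N}} →
             t ℕ.≤ N → s₁ ℕ.≤ N * 60 + 60 → s₂ + p ℕ.≤ 15 * t + 21 →
             s₃ + o ℕ.≤ t * (t * 8 + 17) + 2 + p →
             7 + (s₁ + (4 + (2 + (s₂ + s₃)))) + o ℕ.≤ polynomial 100 2 N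
time-bound {N} {t} {s₁} {s₂} {s₃} {p} {o} t≤N s₁≤ s₂≤ s₃≤ = begin
  7 + (s₁ + (4 + (2 + (s₂ + s₃)))) + o
    ≡⟨ solve 4 (λ a b c o → con 7 :+ (a :+ (con 4 :+ (con 2 :+ (b :+ c)))) :+ o :≡ a :+ (b :+ (c :+ o)) :+ con 13)
         refl s₁ s₂ s₃ o ⟩
  s₁ + (s₂ + (s₃ + o)) + 13
    ≤⟨ ℕ.+-monoˡ-≤ 13 (ℕ.+-mono-≤ s₁≤ (ℕ.+-monoʳ-≤ s₂ s₃≤)) ⟩
  N * 60 + 60 + (s₂ + (t * (t * 8 + 17) + 2 + p)) + 13
    ≡⟨ solve 4 (λ N s t p → N :* con 60 :+ con 60 :+ (s :+ (t :* (t :* con 8 :+ con 17) :+ con 2 :+ p)) :+ con 13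
                         :≡ N :* con 60 :+ (s :+ p) :+ t :* (t :* con 8 :+ con 17) :+ con 75) refl N s₂ t p ⟩
  N * 60 + (s₂ + p) + t * (t * 8 + 17) + 75
    ≤⟨ ℕ.+-monoˡ-≤ 75 (ℕ.+-mono-≤ (ℕ.+-monoʳ-≤ (N * 60) s₂≤) ℕ.≤-refl) ⟩
  N * 60 + (15 * t + 21) + t * (t * 8 + 17) + 75
    ≤⟨ ℕ.+-monoˡ-≤ 75 (ℕ.+-mono-≤ (ℕ.+-monoʳ-≤ (N * 60) (ℕ.+-monoˡ-≤ 21 (ℕ.*-monoʳ-≤ 15 t≤N)))
         (ℕ.*-mono-≤ t≤N (ℕ.+-monoˡ-≤ 17 (ℕ.*-monoˡ-≤ 8 t≤N)))) ⟩
  N * 60 + (15 * N + 21) + N * (N * 8 + 17) + 75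
    ≡⟨ solve 1 (λ N → N :* con 60 :+ (con 15 :* N :+ con 21) :+ N :* (N :* con 8 :+ con 17) :+ con 75
                   :≡ con 92 :* N :+ con 8 :* (N :* N) :+ con 96) refl N ⟩
  92 * N + 8 * (N * N) + 96
    -- As `N` is positive, `N ≤ N * N` absorbs the linear term.
    ≤⟨ ℕ.+-mono-≤ (ℕ.+-monoˡ-≤ (8 * (N * N)) (ℕ.*-monoʳ-≤ 92 (ℕ.m≤m*n N N))) (ℕ.m≤m+n 96 4) ⟩
  92 * (N * N) + 8 * (N * N) + 100
    ≡⟨ solve 1 (λ N → con 92 :* (N :* N) :+ con 8 :* (N :* N) :+ con 100
                   :≡ con 100 :* (N :* (N :* con 1)) :+ con 100) refl N ⟩
  100 * N ^ 2 + 100 ∎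
  where
  open ℕ.≤-Reasoning
  open ℕ-Solver using (solve; con; _:+_; _:*_) renaming (_:=_ to _:≡_)

theorem14 : Σ[ p ∈ Program ] Σ[ c ∈ ℕ ] Σ[ k ∈ ℕ ]
    ((T : Tree) → MaxDegree≤ 3 T → degree {T} root ≡ 2 →
    (x y : Vertex T → ℚ) → Feasible T x y →
    Σ[ σ ∈ Strategy T ]
    ((Computes p from encodeInput T x y to encodeStrategy σ
    within polynomial c k (size (encodeInput T x y)))
    × ∑ y ≤ (+ savedCount σ) / 1))
theorem14 = firefighter , 100 , 2 , λ T Δ≤3 root₂ x y feasible →
  let N       = size (encodeInput T x y)
      size≤N  = ℕ.m≤n⇒m≤1+n (ℕ.m≤m+n (size (encodeTree T)) _)
      t , S , d , q , n , s₁ , searches , t≤h , S≤1 , s₁≤ =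
        search-runs (maxDegree⇒binary Δ≤3 root₂) N (T , here) [] []
          (ℕ.≤-trans (ℕ.≤-reflexive (trans (ℕ.+-identityʳ _) (ℕ.+-identityʳ _))) size≤N)
          -- This fixes `h` as `exitDepth T`, since the root has depth 0.
          (inj₁ (here ℕ.≤-refl))
      r , w , s₂ , ends , s₂≤ = endgame-runs d S≤1
      ρ , s₃ , climbs , s₃≤   = climb-runs d (endgame S)
      σ = extend d (endgame S)
  in σ
   , ( ρ , _
     , seq assign (seq searches (seq assign (seq assign (seq ends climbs))))
     , time-bound (ℕ.≤-trans t≤h (ℕ.≤-trans (exitDepth≤size T) size≤N)) s₁≤ s₂≤ s₃≤)
   -- The descent burns at most `t` vertices and the endgame one more.
   , ∑y-bound feasible {s = savedCount σ} (ℕ.≤-trans (ℕ.≤-reflexive (ℕ.+-comm t 1)) (s≤s t≤h))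
       (length≤filter (saved? σ) (burns-extend d (burns-endgame S S≤1)))
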